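{- Let $q=3^r$ with $r\ge 1$, and let $d\ge 2$ satisfy $d\equiv 2\pmod 3$. On $\mathbb F_q^d$, let $Q(x)=x_1^2+\cdots+x_d^2$, let $e_1,\ldots,e_d$ be the standard basis, and let $\mathbf 1=(1,\ldots,1)$. For $1\le i<j\le d$ define $u_{ij}=\mathbf 1-2e_i-2e_j$ (so $u_{ij}$ has entries $-1$ in positions $i,j$ and entries $1$ elsewhere), and for $1\le i\le d$ define $v_i=-\mathbf 1+2e_i$ (so $v_i$ has entry $1$ in position $i$ and entries $-1$ elsewhere). Put $$S_d=\{0,\mathbf 1\}\cup\{\pm e_i:1\le i\le d\}\cup\{u_{ij}:1\le i<j\le d\}\cup\{v_i:1\le i\le d\}.$$ Then $S_d$ is a two-distance set with nonzero squared distances $1,2\in\mathbb F_q$, and $$|S_d|=\binom{d+2}{2}+d+1.$$ Consequently, the upper bound $|S|\le\binom{d+2}{2}+d+1$, valid for every two-distance set $S$ in $\mathbb F_q^d$ with two distinct nonzero squared distances, is attained in infinitely many dimensions $d$.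
   Context: A set $S\subseteq\mathbb F_q^d$ is a two-distance set if $Q(x-y)$, over distinct $x,y\in S$, takes exactly two values; these values are called its squared distances. The bound $|S|\le\binom{d+2}{2}+d+1$ for two-distance sets with distinct nonzero squared distances (over any field of characteristic different from $2$) is referred to as the Larman--Rogers--Seidel bound. -}

module Defs where

open import Level using (Level; _⊔_; suc)
open import Algebra.Apartness.Bundles using (HeytingCommutativeRing; HeytingField)
open import Algebra.Bundles using (CommutativeRing)
open import Algebra.Definitions.RawMonoid using (sum)
open import Data.Bool.Base using (if_then_else_)
open import Data.Fin.Base using (Fin; _<_)
open import Data.Fin.Properties using (_≟_)
open import Data.Nat.Base as ℕ using (ℕ)
open import Data.Nat.Combinatorics using (_C_)
open import Data.Product.Base using (Σ; _×_; ∃-syntax; proj₁)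
open import Data.Sum.Base using (_⊎_)
open import Data.Vec.Functional using (Vector; replicate)
import Data.Vec.Functional.Relation.Binary.Equality.Setoid as VectorEquality
open import Function.Bundles using (Injection; Inverse; _⇔_)
open import Relation.Binary.Bundles using (Setoid)
import Relation.Binary.Construct.On as On
import Relation.Binary.PropositionalEquality.Properties as ≡
open import Relation.Nullary.Decidable.Core using (does)
open import Relation.Nullary.Negation.Core using (¬_)
open import Relation.Unary using (Pred; _∈_)

HasSize : ∀ {a ℓ} → Setoid a ℓ → ℕ → Set (a ⊔ ℓ)
HasSize A n = Inverse A (≡.setoid (Fin n))

-- No n pairwise distinct elements with n > m.  Unlike HasSize, this makes
-- sense without first enumerating A.
HasSizeAtMost : ∀ {a ℓ} → Setoid a ℓ → ℕ → Set (a ⊔ ℓ)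
HasSizeAtMost A m = ∀ n → Injection (≡.setoid (Fin n)) A → n ℕ.≤ m

bound : ℕ → ℕ
bound d = (d ℕ.+ 2) C 2 ℕ.+ d ℕ.+ 1

-- When the setoid of F has finite size, equality is decidable, _#_ coincides
-- with _≉_, and every element distinct from 0# is invertible, so F is a finite
-- field in the usual sense.
module Space {c ℓ₁ ℓ₂} (F : HeytingField c ℓ₁ ℓ₂) where
  ring : CommutativeRing c ℓ₁
  ring = HeytingCommutativeRing.commutativeRing (HeytingField.heytingCommutativeRing F)

  open CommutativeRing ring
    using (Carrier; _≈_; _+_; _*_; _-_; -_; setoid; +-rawMonoid)
  open CommutativeRing ring public using (0#; 1#; _≉_)
  open VectorEquality setoid public using (_≋_; ≋-setoid)

  2# : Carrier
  2# = 1# + 1#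

  Point : ℕ → Set c
  Point d = Vector Carrier d

  infixl 6 _⊖_
  _⊖_ : ∀ {d} → Point d → Point d → Point d
  (x ⊖ y) k = x k - y k

  infix 8 ⊖_
  ⊖_ : ∀ {d} → Point d → Point d
  (⊖ x) k = - x k

  infixl 6 _⊕_
  _⊕_ : ∀ {d} → Point d → Point d → Point d
  (x ⊕ y) k = x k + y k

  infixr 7 _·_
  _·_ : ∀ {d} → Carrier → Point d → Point d
  (a · x) k = a * x k

  Q : ∀ {d} → Point d → Carrier
  Q x = sum +-rawMonoid (λ i → x i * x i)

  subsetSetoid : ∀ {d} → Pred (Point d) ℓ₁ → Setoid (c ⊔ ℓ₁) ℓ₁
  subsetSetoid {d} S = On.setoid {B = Σ (Point d) S} (≋-setoid d) proj₁

  IsSquaredDistance : ∀ {d} → Pred (Point d) ℓ₁ → Pred Carrier (c ⊔ ℓ₁)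
  IsSquaredDistance S a =
    ∃[ x ] ∃[ y ] x ∈ S × y ∈ S × ¬ (x ≋ y) × Q (x ⊖ y) ≈ a

  IsTwoDistanceSet : ∀ {d} → Pred (Point d) ℓ₁ → Carrier → Carrier → Set (c ⊔ ℓ₁)
  IsTwoDistanceSet S a b =
    a ≉ b × (∀ t → IsSquaredDistance S t ⇔ (t ≈ a ⊎ t ≈ b))

  BoundValid : ℕ → Set (c ⊔ suc ℓ₁)
  BoundValid d =
    ∀ (S : Pred (Point d) ℓ₁) a b → IsTwoDistanceSet S a b → a ≉ 0# → b ≉ 0# →
    HasSizeAtMost (subsetSetoid S) (bound d)

  BoundAttained : ℕ → Set (c ⊔ suc ℓ₁)
  BoundAttained d =
    ∃[ S ] ∃[ a ] ∃[ b ] IsTwoDistanceSet {d} S a b × a ≉ 0# × b ≉ 0# ×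
    HasSize (subsetSetoid S) (bound d)

  𝟎 𝟏 : ∀ {d} → Point d
  𝟎 = replicate _ 0#
  𝟏 = replicate _ 1#

  e : ∀ {d} → Fin d → Point d
  e i k = if does (i ≟ k) then 1# else 0#

  u : ∀ {d} → Fin d → Fin d → Point d
  u i j = 𝟏 ⊖ 2# · e i ⊖ 2# · e j

  v : ∀ {d} → Fin d → Point d
  v i = ⊖ 𝟏 ⊕ 2# · e i

  -- Membership is stated up to _≋_, so that 𝒮 d is closed under equality of
  -- points; subsetSetoid ignores which constructor is used.
  data 𝒮 (d : ℕ) (x : Point d) : Set ℓ₁ where
    is-𝟎  : x ≋ 𝟎 → 𝒮 d x
    is-𝟏  : x ≋ 𝟏 → 𝒮 d x
    is-e  : ∀ i → x ≋ e i → 𝒮 d x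
    is-⊖e : ∀ i → x ≋ ⊖ e i → 𝒮 d x
    is-u  : ∀ i j → i < j → x ≋ u i j → 𝒮 d x
    is-v  : ∀ i → x ≋ v i → 𝒮 d x

{-# OPTIONS --safe #-}
module Submission where

-- Size of 𝒮 d.  The subfield 𝔽₃ of F contains all coordinates, and since
-- -2 = 1 we have Q(x - y) = Q(x) + Q(y) + ⟨x,y⟩.  Every point is a combination
-- of 𝟏 and the e i, whose Gram matrix over 𝔽₃ is known because ⟨𝟏,𝟏⟩ = d = -1.
-- So squared distances of labelled points are computed in 𝔽₃; they vanish for
-- equal labels only, hence distinct labels give distinct points.
--
-- Upper bound.  For y ∈ S the polynomial (Q(x - y) - a)(Q(x - y) - b) vanishes
-- at all points of S except y, and all these polynomials lie in the span of
-- bound d monomials.  So a weight w : Fin n → F on n points is determined by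
-- the bound d sums of the monomials against w.  This embeds Fⁿ into
-- F^(bound d), whence q^n ≤ q^(bound d): counting replaces linear algebra.

open import Defs
open import Algebra.Apartness.Bundles using (HeytingField)
import Algebra.Apartness.Properties.HeytingCommutativeRing as HeytingProperties
open import Algebra.Bundles using (CommutativeRing; RawRing)
import Algebra.Properties.CommutativeSemigroup as CommutativeSemigroupProperties
import Algebra.Properties.Ring as RingProperties
import Algebra.Properties.Semiring.Mult as Mult
import Algebra.Properties.Semiring.Sum as Sum
import Algebra.Solver.Ring as RingSolver
open import Algebra.Solver.Ring.AlmostCommutativeRing
  using (fromCommutativeRing; _-Raw-AlmostCommutative⟶_)
import Algebra.Solver.Ring.NaturalCoefficients.Default as NaturalSolver
open import Data.Bool.Base using (if_then_else_; true; false)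
open import Data.Empty using (⊥)
open import Data.Fin.Base as Fin using (Fin; zero; suc; punchIn; finToFun; funToFin)
open import Data.Fin.Patterns using (0F; 1F; 2F)
open import Data.Fin.Properties as Fin
  using (_≟_; +↔⊎; *↔×; funToFin-finToFin; finToFun-funToFin; injective⇒≤; punchInᵢ≢i)
open import Data.List.Base using (List; []; _∷_)
open import Data.Maybe.Base using (Maybe; just; nothing)
open import Data.Nat.Base as ℕ using (ℕ; zero; suc; _^_; _≤_; _<_; _%_; s≤s; z≤n)
open import Data.Nat.Combinatorics using (_C_; nC1≡n; nCk+nC[k+1]≡[n+1]C[k+1])
open import Data.Nat.DivMod using (m≡m%n+[m/n]*n; [m+kn]%n≡m%n)
import Data.Nat.Properties as ℕ
open import Data.Nat.Solver using (module +-*-Solver)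
open import Data.Product.Base using (Σ; _×_; _,_; ∃-syntax; proj₁; proj₂)
open import Data.Sum.Base as Sum⊎ using (_⊎_; inj₁; inj₂)
open import Data.Sum.Function.Propositional using (_⊎-↔_)
open import Data.Unit.Base using (⊤)
open import Data.Vec.Functional using (Vector)
open import Function.Base using (_∘_)
open import Function.Bundles using (Inverse; Injection; Equivalence; _↔_; mk↔ₛ′; mk⇔)
open import Function.Construct.Composition using (_↔-∘_)
open import Function.Construct.Identity using (↔-id)
open import Function.Construct.Symmetry using (↔-sym)
open import Relation.Binary.Definitions using (tri<; tri≈; tri>)
open import Relation.Binary.PropositionalEquality as ≡ using (_≡_; _≢_)
import Relation.Binary.Reasoning.Setoid as SetoidReasoning
open import Relation.Nullary using (yes; no; contradiction; does)
open import Relation.Nullary.Decidable using (dec-true; dec-false)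

-- Enumeration of the labels.

Pair : ℕ → Set
Pair d = Σ (Fin d) λ i → Σ (Fin d) λ j → i Fin.< j

-- A pair with smaller entry `zero` is determined by its larger entry, and every other pair is a
-- shifted pair from `Fin d`. This is the combinatorial form of Pascal's rule for `suc d C 2`.
pair-suc : ∀ d → Pair (suc d) ↔ (Fin d ⊎ Pair d)
pair-suc d = mk↔ₛ′ to from to∘from from∘to
  where
  to : Pair (suc d) → Fin d ⊎ Pair d
  to (zero  , suc j , _)       = inj₁ j
  to (suc i , suc j , s≤s i<j) = inj₂ (i , j , i<j)

  from : Fin d ⊎ Pair d → Pair (suc d)
  from (inj₁ j)             = zero , suc j , s≤s z≤n
  from (inj₂ (i , j , i<j)) = suc i , suc j , s≤s i<j

  to∘from : ∀ x → to (from x) ≡ x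
  to∘from (inj₁ _) = ≡.refl
  to∘from (inj₂ _) = ≡.refl

  from∘to : ∀ x → from (to x) ≡ x
  from∘to (zero  , suc _ , s≤s z≤n) = ≡.refl
  from∘to (suc _ , suc _ , s≤s _)   = ≡.refl

≡⇒↔ : ∀ {m n} → m ≡ n → Fin m ↔ Fin n
≡⇒↔ ≡.refl = ↔-id _

[1+n]C2≡n+nC2 : ∀ n → suc n C 2 ≡ n ℕ.+ n C 2
[1+n]C2≡n+nC2 n =
  ≡.trans (≡.sym (nCk+nC[k+1]≡[n+1]C[k+1] n 1)) (≡.cong (ℕ._+ n C 2) (nC1≡n n))

pair↔ : ∀ d → Pair d ↔ Fin (d C 2)
pair↔ zero    = mk↔ₛ′ (λ ()) (λ ()) (λ ()) (λ ())
pair↔ (suc d) = ≡⇒↔ (≡.sym ([1+n]C2≡n+nC2 d)) ↔-∘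
  (↔-sym +↔⊎ ↔-∘ ((↔-id _ ⊎-↔ pair↔ d) ↔-∘ pair-suc d))

-- Labels both the points of 𝒮 d and the monomials 1, Q², xᵢ, xᵢ², xᵢQ, xᵢxⱼ
-- that span the polynomials (Q(x - y) - a)(Q(x - y) - b).
Index : ℕ → Set
Index d = Fin 2 ⊎ (Fin 3 × Fin d) ⊎ Pair d

pattern const κ      = inj₁ κ
pattern single κ i   = inj₂ (inj₁ (κ , i))
pattern pair i j i<j = inj₂ (inj₂ (i , j , i<j))

-- Two steps of Pascal's rule raise `d C 2` to `(d + 2) C 2` at the cost of `d` and `d + 1`, which
-- leaves `d + 1` of the original `2 + 3d`.
index-count : ∀ d → 2 ℕ.+ (3 ℕ.* d ℕ.+ d C 2) ≡ bound d
index-count d = begin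
  2 ℕ.+ (3 ℕ.* d ℕ.+ d C 2)
    ≡⟨ solve 2 (λ n c → con 2 :+ (con 3 :* n :+ c)
                     := (con 1 :+ n) :+ (n :+ c) :+ n :+ con 1) ≡.refl d (d C 2) ⟩
  suc d ℕ.+ (d ℕ.+ d C 2) ℕ.+ d ℕ.+ 1
    ≡⟨ ≡.cong (λ c → suc d ℕ.+ c ℕ.+ d ℕ.+ 1) ([1+n]C2≡n+nC2 d) ⟨
  suc d ℕ.+ suc d C 2 ℕ.+ d ℕ.+ 1
    ≡⟨ ≡.cong (λ c → c ℕ.+ d ℕ.+ 1) ([1+n]C2≡n+nC2 (suc d)) ⟨
  suc (suc d) C 2 ℕ.+ d ℕ.+ 1
    ≡⟨ ≡.cong (λ n → n C 2 ℕ.+ d ℕ.+ 1) (ℕ.+-comm 2 d) ⟩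
  bound d ∎
  where
  open ≡.≡-Reasoning
  open +-*-Solver

abstract
  -- Kept abstract because the inverse laws suffice below and unfolding the composite bijection
  -- would only produce large terms.
  index↔ : ∀ d → Index d ↔ Fin (bound d)
  index↔ d = ≡⇒↔ (index-count d) ↔-∘
    (↔-sym +↔⊎ ↔-∘ (↔-id _ ⊎-↔ (↔-sym +↔⊎ ↔-∘ (↔-sym *↔× ⊎-↔ pair↔ d))))

-- Arithmetic in the field of three elements and the Gram matrix over it.

data 𝔽₃ : Set where
  0₃ 1₃ -1₃ : 𝔽₃

infixl 6 _+₃_
_+₃_ : 𝔽₃ → 𝔽₃ → 𝔽₃
0₃  +₃ y   = y
1₃  +₃ 0₃  = 1₃
1₃  +₃ 1₃  = -1₃
1₃  +₃ -1₃ = 0₃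
-1₃ +₃ 0₃  = -1₃
-1₃ +₃ 1₃  = 0₃
-1₃ +₃ -1₃ = 1₃

-₃_ : 𝔽₃ → 𝔽₃
-₃ 0₃  = 0₃
-₃ 1₃  = -1₃
-₃ -1₃ = 1₃

infixl 7 _*₃_
_*₃_ : 𝔽₃ → 𝔽₃ → 𝔽₃
0₃  *₃ y = 0₃
1₃  *₃ y = y
-1₃ *₃ y = -₃ y

𝔽₃-rawRing : RawRing _ _
𝔽₃-rawRing = record
  { Carrier = 𝔽₃ ; _≈_ = _≡_ ; _+_ = _+₃_ ; _*_ = _*₃_ ; -_ = -₃_ ; 0# = 0₃ ; 1# = 1₃ }

-- Defined by recursion, so that the proof can be left as `_` as soon as the argument evaluates to a
-- nonzero constant.
IsUnit : 𝔽₃ → Set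
IsUnit 0₃  = ⊥
IsUnit 1₃  = ⊤
IsUnit -1₃ = ⊤

-- nothing stands for 𝟏 and just i for e i.
Generator : ℕ → Set
Generator d = Maybe (Fin d)

Combination : ℕ → Set
Combination d = List (𝔽₃ × Generator d)

-- The test is written `j ≟ i` to match `e j i`, the coordinate to which the inner product of `e i`
-- and `e j` reduces.
gram : ∀ {d} → Generator d → Generator d → 𝔽₃
gram nothing  nothing  = -1₃
gram nothing  (just _) = 1₃
gram (just _) nothing  = 1₃
gram (just i) (just j) = if does (j ≟ i) then 1₃ else 0₃

dot-generator : ∀ {d} → Generator d → Combination d → 𝔽₃
dot-generator g []             = 0₃
dot-generator g ((b , h) ∷ ys) = b *₃ gram g h +₃ dot-generator g ys

dot : ∀ {d} → Combination d → Combination d → 𝔽₃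
dot []             ys = 0₃
dot ((a , g) ∷ xs) ys = a *₃ dot-generator g ys +₃ dot xs ys

-- 0F, 1F and 2F stand for the families e, ⊖ e and v.
𝟏-coefficient e-coefficient : Fin 3 → 𝔽₃
𝟏-coefficient 0F = 0₃
𝟏-coefficient 1F = 0₃
𝟏-coefficient 2F = -1₃
e-coefficient 0F = 1₃
e-coefficient 1F = -1₃
e-coefficient 2F = -1₃

-- In characteristic 3, u i j = 𝟏 + e i + e j and v i = - 𝟏 - e i.
combination : ∀ {d} → Index d → Combination d
combination (const 0F)   = []
combination (const 1F)   = (1₃ , nothing) ∷ []
combination (single κ i) = (𝟏-coefficient κ , nothing) ∷ (e-coefficient κ , just i) ∷ []
combination (pair i j _) = (1₃ , nothing) ∷ (1₃ , just i) ∷ (1₃ , just j) ∷ []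

-- The inner product of a labelled point with itself, given without tests such as `i ≟ i`, which do
-- not evaluate for a variable `i`.
norm : ∀ {d} → Index d → 𝔽₃
norm (const 0F)    = 0₃
norm (const 1F)    = -1₃
norm (single 0F _) = 1₃
norm (single 1F _) = 1₃
norm (single 2F _) = -1₃
norm (pair _ _ _)  = -1₃

≟-refl : ∀ {d} (i : Fin d) → does (i ≟ i) ≡ true
≟-refl i = dec-true (i ≟ i) ≡.refl

dot-combination : ∀ {d} (l : Index d) → dot (combination l) (combination l) ≡ norm l
dot-combination (const 0F)    = ≡.refl
dot-combination (const 1F)    = ≡.refl
dot-combination (single 0F i) rewrite ≟-refl i = ≡.refl
dot-combination (single 1F i) rewrite ≟-refl i = ≡.refl
dot-combination (single 2F i) rewrite ≟-refl i = ≡.refl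
dot-combination (pair i j i<j)
  rewrite ≟-refl i | ≟-refl j
        | dec-false (i ≟ j) (Fin.<⇒≢ i<j) | dec-false (j ≟ i) (Fin.<⇒≢ i<j ∘ ≡.sym) = ≡.refl

-- Q(x - y) = Q(x) + Q(y) - 2⟨x,y⟩, and -2 = 1.
distance : ∀ {d} → Index d → Index d → 𝔽₃
distance l m = norm l +₃ norm m +₃ dot (combination l) (combination m)

-- Once the equality tests between the indices are decided, `distance l m` evaluates to a constant
-- of `𝔽₃`, so each consistent case with distinct labels closes by computation.
separated : ∀ {d} (l m : Index d) → l ≡ m ⊎ IsUnit (distance l m)
separated (const 0F)     (const 0F)     = inj₁ ≡.refl
separated (const 0F)     (const 1F)     = inj₂ _
separated (const 0F)     (single 0F _)  = inj₂ _
separated (const 0F)     (single 1F _)  = inj₂ _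
separated (const 0F)     (single 2F _)  = inj₂ _
separated (const 0F)     (pair _ _ _)   = inj₂ _
separated (const 1F)     (const 0F)     = inj₂ _
separated (const 1F)     (const 1F)     = inj₁ ≡.refl
separated (const 1F)     (single 0F _)  = inj₂ _
separated (const 1F)     (single 1F _)  = inj₂ _
separated (const 1F)     (single 2F _)  = inj₂ _
separated (const 1F)     (pair _ _ _)   = inj₂ _
separated (single 0F _)  (const 0F)     = inj₂ _
separated (single 1F _)  (const 0F)     = inj₂ _
separated (single 2F _)  (const 0F)     = inj₂ _
separated (single 0F _)  (const 1F)     = inj₂ _
separated (single 1F _)  (const 1F)     = inj₂ _
separated (single 2F _)  (const 1F)     = inj₂ _
separated (pair _ _ _)   (const 0F)     = inj₂ _
separated (pair _ _ _)   (const 1F)     = inj₂ _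
separated (single κ i) (single κ′ k) with k ≟ i
separated (single 0F _) (single 0F _) | yes ≡.refl = inj₁ ≡.refl
separated (single 0F _) (single 1F _) | yes ≡.refl = inj₂ _
separated (single 0F _) (single 2F _) | yes ≡.refl = inj₂ _
separated (single 1F _) (single 0F _) | yes ≡.refl = inj₂ _
separated (single 1F _) (single 1F _) | yes ≡.refl = inj₁ ≡.refl
separated (single 1F _) (single 2F _) | yes ≡.refl = inj₂ _
separated (single 2F _) (single 0F _) | yes ≡.refl = inj₂ _
separated (single 2F _) (single 1F _) | yes ≡.refl = inj₂ _
separated (single 2F _) (single 2F _) | yes ≡.refl = inj₁ ≡.refl
separated (single 0F _) (single 0F _) | no _ = inj₂ _
separated (single 0F _) (single 1F _) | no _ = inj₂ _
separated (single 0F _) (single 2F _) | no _ = inj₂ _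
separated (single 1F _) (single 0F _) | no _ = inj₂ _
separated (single 1F _) (single 1F _) | no _ = inj₂ _
separated (single 1F _) (single 2F _) | no _ = inj₂ _
separated (single 2F _) (single 0F _) | no _ = inj₂ _
separated (single 2F _) (single 1F _) | no _ = inj₂ _
separated (single 2F _) (single 2F _) | no _ = inj₂ _
separated (single κ i) (pair k l k<l) with k ≟ i | l ≟ i
... | yes ≡.refl | yes ≡.refl = contradiction ≡.refl (Fin.<⇒≢ k<l)
separated (single 0F _) (pair _ _ _) | yes _ | no  _ = inj₂ _
separated (single 0F _) (pair _ _ _) | no  _ | yes _ = inj₂ _
separated (single 0F _) (pair _ _ _) | no  _ | no  _ = inj₂ _
separated (single 1F _) (pair _ _ _) | yes _ | no  _ = inj₂ _
separated (single 1F _) (pair _ _ _) | no  _ | yes _ = inj₂ _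
separated (single 1F _) (pair _ _ _) | no  _ | no  _ = inj₂ _
separated (single 2F _) (pair _ _ _) | yes _ | no  _ = inj₂ _
separated (single 2F _) (pair _ _ _) | no  _ | yes _ = inj₂ _
separated (single 2F _) (pair _ _ _) | no  _ | no  _ = inj₂ _
separated (pair k l k<l) (single κ i) with i ≟ k | i ≟ l
... | yes ≡.refl | yes ≡.refl = contradiction ≡.refl (Fin.<⇒≢ k<l)
separated (pair _ _ _) (single 0F _) | yes _ | no  _ = inj₂ _
separated (pair _ _ _) (single 0F _) | no  _ | yes _ = inj₂ _
separated (pair _ _ _) (single 0F _) | no  _ | no  _ = inj₂ _
separated (pair _ _ _) (single 1F _) | yes _ | no  _ = inj₂ _
separated (pair _ _ _) (single 1F _) | no  _ | yes _ = inj₂ _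
separated (pair _ _ _) (single 1F _) | no  _ | no  _ = inj₂ _
separated (pair _ _ _) (single 2F _) | yes _ | no  _ = inj₂ _
separated (pair _ _ _) (single 2F _) | no  _ | yes _ = inj₂ _
separated (pair _ _ _) (single 2F _) | no  _ | no  _ = inj₂ _
separated (pair i j i<j) (pair k l k<l) with k ≟ i | l ≟ i | k ≟ j | l ≟ j
-- These five cases are impossible: the first four identify the two ends of one ordered pair, and
-- the fifth forces `k = j` and `l = i`, against both orders.
... | yes ≡.refl | yes ≡.refl | _          | _          = contradiction ≡.refl (Fin.<⇒≢ k<l)
... | _          | _          | yes ≡.refl | yes ≡.refl = contradiction ≡.refl (Fin.<⇒≢ k<l)
... | yes ≡.refl | _          | yes ≡.refl | _          = contradiction ≡.refl (Fin.<⇒≢ i<j)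
... | _          | yes ≡.refl | _          | yes ≡.refl = contradiction ≡.refl (Fin.<⇒≢ i<j)
... | no _       | yes ≡.refl | yes ≡.refl | no _       = contradiction k<l (Fin.<-asym i<j)
... | yes ≡.refl | no _       | no _       | yes ≡.refl =
  inj₁ (≡.cong (λ i<j → pair i j i<j) (ℕ.<-irrelevant i<j k<l))
-- Modulo 3 the inner product is the number of common indices, so the distance is 1 for disjoint
-- pairs and 2 for pairs with one index in common.
... | no _       | no _       | no _       | no _       = inj₂ _
... | yes _      | no _       | no _       | no _       = inj₂ _
... | no _       | yes _      | no _       | no _       = inj₂ _
... | no _       | no _       | yes _      | no _       = inj₂ _
... | no _       | no _       | no _       | yes _      = inj₂ _

-- Functions between finite sets coded as numbers.

funToFin-cong : ∀ {m n} {f g : Fin m → Fin n} → (∀ i → f i ≡ g i) → funToFin f ≡ funToFin g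
funToFin-cong {zero}  f≗g = ≡.refl
funToFin-cong {suc m} f≗g = ≡.cong₂ Fin.combine (f≗g zero) (funToFin-cong (f≗g ∘ suc))

-- A number below `n ^ m` is recovered from its `m` digits in base `n`.
finToFun-injective : ∀ {m n} {k l : Fin (n ^ m)} →
  (∀ i → finToFun {n} {m} k i ≡ finToFun l i) → k ≡ l
finToFun-injective {m} {n} {k} {l} k≗l =
  ≡.trans (≡.sym (funToFin-finToFin {m} k)) (≡.trans (funToFin-cong k≗l) (funToFin-finToFin {m} l))

-- Sums in commutative rings and the order of the additive group.

module _ {c ℓ} (R : CommutativeRing c ℓ) where
  open CommutativeRing R
  open Mult semiring using () renaming (_×_ to _×ᴿ_)
  open Sum semiring
  open RingProperties ring using (+-cancelˡ)
  open SetoidReasoning setoid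

  -- Translation by x permutes the elements, hence does not change their sum.
  size×≈0 : ∀ {n} → HasSize setoid n → ∀ x → n ×ᴿ x ≈ 0#
  size×≈0 {n} size x = +-cancelˡ (sum from) _ _ (begin
    sum from + n ×ᴿ x                ≈⟨ +-congˡ (sum-replicate n) ⟨
    sum from + ∑[ i < n ] x          ≈⟨ ∑-distrib-+ from (λ _ → x) ⟨
    ∑[ i < n ] (from i + x)          ≈⟨ sum-cong-≋ (λ i → strictlyInverseʳ (from i + x)) ⟨
    ∑[ i < n ] from (translate x i)  ≈⟨ sum-permute from translation ⟨
    sum from                         ≈⟨ +-identityʳ _ ⟨
    sum from + 0#                    ∎)
    where
    open Inverse size

    translate : Carrier → Fin n → Fin n
    translate y i = to (from i + y)

    translate-inverse : ∀ {y z} → y + z ≈ 0# → ∀ i → translate z (translate y i) ≡ i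
    translate-inverse {y} {z} y+z≈0 i = ≡.trans
      (to-cong (begin
        from (translate y i) + z ≈⟨ +-congʳ (strictlyInverseʳ _) ⟩
        from i + y + z           ≈⟨ +-assoc _ _ _ ⟩
        from i + (y + z)         ≈⟨ +-congˡ y+z≈0 ⟩
        from i + 0#              ≈⟨ +-identityʳ _ ⟩
        from i                   ∎))
      (strictlyInverseˡ i)

    translation : Fin n ↔ Fin n
    translation = mk↔ₛ′ (translate x) (translate (- x))
      (translate-inverse (-‿inverseˡ x)) (translate-inverse (-‿inverseʳ x))

  sum-single : ∀ {n} (t : Vector Carrier n) i → (∀ k → k ≢ i → t k ≈ 0#) → sum t ≈ t i
  sum-single {suc n} t i others≈0 = begin
    sum t                             ≈⟨ sum-remove t ⟩
    t i + ∑[ k < n ] t (punchIn i k)  ≈⟨ +-congˡ (sum-cong-≋ λ k → others≈0 _ (punchInᵢ≢i i k)) ⟩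
    t i + ∑[ k < n ] 0#               ≈⟨ +-congˡ (sum-replicate-zero n) ⟩
    t i + 0#                          ≈⟨ +-identityʳ _ ⟩
    t i                               ∎

-- Cancellation and characteristic in a Heyting field.

module Field {c ℓ₁ ℓ₂} (F : HeytingField c ℓ₁ ℓ₂) where
  open HeytingField F using (heytingCommutativeRing; tight; #⇒invertible; #-irrefl)
  open HeytingProperties heytingCommutativeRing using (x-0≈x; 1#0)
  open Space F hiding (ring; _≉_; 0#; 1#)
  open CommutativeRing (Space.ring F) hiding (zero)
  open Mult semiring using (×-homo-+; ×-congˡ; ×1-homo-*) renaming (_×_ to _×ᴿ_)
  open Sum semiring
  open RingProperties ring
    using (-0#≈0#; -‿involutive; -1*x≈-x; x≈y⇒x∙y⁻¹≈ε; x∙y⁻¹≈ε⇒x≈y; +-cancelʳ; //-rightDividesˡ)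
  open SetoidReasoning setoid

  1≉0 : 1# ≉ 0#
  1≉0 1≈0 = #-irrefl 1≈0 1#0

  -- By tightness it suffices to refute `x # 0#`. Apartness would make `x` invertible, and
  -- multiplying `x * y ≈ 0#` by the inverse would give `y ≈ 0#`.
  *-cancelʳ-0 : ∀ {x y} → y ≉ 0# → x * y ≈ 0# → x ≈ 0#
  *-cancelʳ-0 {x} {y} y≉0 xy≈0 = proj₁ (tight x 0#) λ x#0 →
    let (x⁻¹ , x⁻¹*[x-0]≈1 , _) = #⇒invertible x#0 in
    y≉0 (begin
      y                    ≈⟨ *-identityˡ y ⟨
      1# * y               ≈⟨ *-congʳ x⁻¹*[x-0]≈1 ⟨
      x⁻¹ * (x - 0#) * y   ≈⟨ *-congʳ (*-congˡ (x-0≈x x)) ⟩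
      x⁻¹ * x * y          ≈⟨ *-assoc _ _ _ ⟩
      x⁻¹ * (x * y)        ≈⟨ *-congˡ xy≈0 ⟩
      x⁻¹ * 0#             ≈⟨ zeroʳ x⁻¹ ⟩
      0#                   ∎)

  -- Brings the characteristic down from `n ^ r` to `n`: if `n` were apart from zero, it could be
  -- cancelled from the power one factor at a time, down to `1# ≈ 0#`.
  ^×1≈0⇒×1≈0 : ∀ n r → (n ^ r) ×ᴿ 1# ≈ 0# → n ×ᴿ 1# ≈ 0#
  ^×1≈0⇒×1≈0 n zero    1+0≈0 = contradiction (trans (sym (+-identityʳ 1#)) 1+0≈0) 1≉0
  ^×1≈0⇒×1≈0 n (suc r) n^[1+r]≈0 = proj₁ (tight _ _) λ n#0 →
    #-irrefl (^×1≈0⇒×1≈0 n r (*-cancelʳ-0 (λ n≈0 → #-irrefl n≈0 n#0)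
      (trans (*-comm _ _) (trans (sym (×1-homo-* n (n ^ r))) n^[1+r]≈0)))) n#0

  ≋⇒Q-⊖≈0 : ∀ {d} {x y : Point d} → x ≋ y → Q (x ⊖ y) ≈ 0#
  ≋⇒Q-⊖≈0 {d} x≋y = trans
    (sum-cong-≋ {d} λ k → trans (*-congʳ (x≈y⇒x∙y⁻¹≈ε (x≋y k))) (zeroˡ _))
    (sum-replicate-zero d)

  -- The upper bound on two-distance sets.

  module Bound {q} (1<q : 1 < q) (size : HasSize setoid q) where
    open CommutativeSemigroupProperties *-commutativeSemigroup using (x∙yz≈y∙xz)
    open NaturalSolver commutativeSemiring
    open Inverse size using ()
      renaming (to to encode; from to decode; to-cong to encode-cong;
                strictlyInverseˡ to encode∘decode; strictlyInverseʳ to decode∘encode)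

    encode-injective : ∀ {x y} → encode x ≡ encode y → x ≈ y
    encode-injective x∼y = trans (sym (decode∘encode _))
      (trans (reflexive (≡.cong decode x∼y)) (decode∘encode _))

    decode-injective : ∀ {i j} → decode i ≈ decode j → i ≡ j
    decode-injective i∼j = ≡.trans (≡.sym (encode∘decode _))
      (≡.trans (encode-cong i∼j) (encode∘decode _))

    -- `Q` itself is left out of the list, being the sum of the squares `x i * x i`.
    monomial : ∀ {d} → Index d → Point d → Carrier
    monomial (const 0F)     x = 1#
    monomial (const 1F)     x = Q x * Q x
    monomial (single 0F i)  x = x i
    monomial (single 1F i)  x = x i * x i
    monomial (single 2F i)  x = x i * Q x
    monomial (pair i j _)   x = x i * x j

    weigh : ∀ {d n} → Vector Carrier n → Vector (Point d) n → (Point d → Carrier) → Carrier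
    weigh w p f = sum (λ i → w i * f (p i))

    -- Linearity in the weight reduces injectivity of the encoding to a trivial kernel.
    weigh-difference : ∀ {d n} (v w : Vector Carrier n) (p : Vector (Point d) n) f →
      weigh v p f ≈ weigh w p f → weigh (λ i → v i - w i) p f ≈ 0#
    weigh-difference {n = n} v w p f v≈w = +-cancelʳ (weigh w p f) _ _ (begin
      weigh (λ i → v i - w i) p f + weigh w p f
        ≈⟨ ∑-distrib-+ {n} _ _ ⟨
      sum (λ i → (v i - w i) * f (p i) + w i * f (p i))
        ≈⟨ sum-cong-≋ {n} (λ i → distribʳ (f (p i)) _ (w i)) ⟨
      sum (λ i → (v i - w i + w i) * f (p i))
        ≈⟨ sum-cong-≋ (λ i → *-congʳ (//-rightDividesˡ (w i) (v i))) ⟩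
      weigh v p f
        ≈⟨ v≈w ⟩
      weigh w p f
        ≈⟨ +-identityˡ _ ⟨
      0# + weigh w p f ∎)

    distance-polynomial : ∀ {d} → Carrier → Carrier → Point d → Point d → Carrier
    distance-polynomial a b y x = (Q (x ⊖ y) - a) * (Q (x ⊖ y) - b)

    -- The linear space of functions annihilated by a weight.

    module Annihilator {d n} (w : Vector Carrier n) (p : Vector (Point d) n)
      (null-monomials : ∀ μ → weigh w p (monomial μ) ≈ 0#) where

      -- A record rather than a bare equation, so that unification can read `f` off the type
      -- `Null f`.
      record Null (f : Point d → Carrier) : Set ℓ₁ where
        constructor null
        field weigh≈0 : weigh w p f ≈ 0#

      null-cong : ∀ {f g} → (∀ x → f x ≈ g x) → Null f → Null g
      null-cong f≈g (null wf≈0) = null (trans (sum-cong-≋ λ i → *-congˡ (sym (f≈g (p i)))) wf≈0)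

      null-+ : ∀ {f g} → Null f → Null g → Null (λ x → f x + g x)
      null-+ {f} {g} (null wf≈0) (null wg≈0) = null (begin
        sum (λ i → w i * (f (p i) + g (p i)))        ≈⟨ sum-cong-≋ (λ i → distribˡ (w i) _ _) ⟩
        sum (λ i → w i * f (p i) + w i * g (p i))    ≈⟨ ∑-distrib-+ {n} _ _ ⟩
        weigh w p f + weigh w p g                    ≈⟨ +-cong wf≈0 wg≈0 ⟩
        0# + 0#                                      ≈⟨ +-identityʳ 0# ⟩
        0#                                           ∎)

      null-* : ∀ a {f} → Null f → Null (λ x → a * f x)
      null-* a {f} (null wf≈0) = null (begin
        sum (λ i → w i * (a * f (p i)))  ≈⟨ sum-cong-≋ (λ i → x∙yz≈y∙xz (w i) a (f (p i))) ⟩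
        sum (λ i → a * (w i * f (p i)))  ≈⟨ *-distribˡ-sum {n} a _ ⟨
        a * weigh w p f                  ≈⟨ *-congˡ wf≈0 ⟩
        a * 0#                           ≈⟨ zeroʳ a ⟩
        0#                               ∎)

      null-sum : ∀ {m} {f : Fin m → Point d → Carrier} →
        (∀ k → Null (f k)) → Null (λ x → ∑[ k < m ] f k x)
      null-sum {zero}  null-f = null (trans (sum-cong-≋ λ i → zeroʳ (w i)) (sum-replicate-zero n))
      null-sum {suc m} null-f = null-+ (null-f zero) (null-sum (null-f ∘ suc))

      monomial-null : ∀ μ → Null (monomial μ)
      monomial-null μ = null (null-monomials μ)

      affine : Carrier → Vector Carrier d → Point d → Carrier
      affine a c x = a + ∑[ k < d ] (c k * x k)

      -- Expanding the affine factor leaves multiples of `f` and of its products with single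
      -- coordinates.
      null-affine-* : ∀ a c {f} → Null f → (∀ k → Null (λ x → x k * f x)) →
        Null (λ x → affine a c x * f x)
      null-affine-* a c {f} null-f null-x* = null-cong (λ x → sym (begin
        (a + ∑[ k < d ] (c k * x k)) * f x           ≈⟨ distribʳ (f x) a _ ⟩
        a * f x + (∑[ k < d ] (c k * x k)) * f x     ≈⟨ +-congˡ (*-distribʳ-sum {d} (f x) _) ⟩
        a * f x + ∑[ k < d ] (c k * x k * f x)       ≈⟨ +-congˡ (sum-cong-≋ λ k → *-assoc (c k) (x k) (f x)) ⟩
        a * f x + ∑[ k < d ] (c k * (x k * f x))     ∎))
        (null-+ (null-* a null-f) (null-sum λ k → null-* (c k) (null-x* k)))

      null-xx : ∀ j k → Null (λ x → x j * x k)
      null-xx j k with Fin.<-cmp j k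
      ... | tri< j<k _ _    = monomial-null (pair j k j<k)
      ... | tri≈ _ ≡.refl _ = monomial-null (single 1F j)
      ... | tri> _ _ k<j    = null-cong (λ x → *-comm (x k) (x j)) (monomial-null (pair k j k<j))

      null-Q : Null Q
      null-Q = null-sum λ k → monomial-null (single 1F k)

      null-affine-*-x : ∀ a c j → Null (λ x → x j * affine a c x)
      null-affine-*-x a c j = null-cong (λ x → *-comm _ (x j))
        (null-affine-* a c (monomial-null (single 0F j)) (λ k → null-xx k j))

      null-affine : ∀ a c → Null (affine a c)
      null-affine a c = null-cong (λ x → *-identityʳ _)
        (null-affine-* a c (monomial-null (const 0F))
          (λ k → null-cong (λ x → sym (*-identityʳ (x k))) (monomial-null (single 0F k))))

      -- With `L` and `M` for the affine forms, the product is `Q² + MQ + L(Q + M)`. Its quartic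
      -- part is `Q²` and its cubic part is `Q` times a linear form, so the listed monomials are
      -- enough.
      null-product : ∀ a c b e → Null (λ x → (Q x + affine a c x) * (Q x + affine b e x))
      null-product a c b e = null-cong
        (λ x → sym (solve 3 (λ q l m → (q :+ l) :* (q :+ m) := q :* q :+ m :* q :+ l :* (q :+ m))
                          refl (Q x) (affine a c x) (affine b e x)))
        (null-+ (null-+ (monomial-null (const 1F))
                        (null-affine-* b e null-Q λ k → monomial-null (single 2F k)))
                (null-affine-* a c (null-+ null-Q (null-affine b e))
                  λ k → null-cong (λ x → sym (distribˡ (x k) _ _))
                    (null-+ (monomial-null (single 2F k)) (null-affine-*-x b e k))))

      -- Written in terms of - y, so that only semiring identities are needed.
      Q-⊖-affine : ∀ x y a → Q (x ⊖ y) - a ≈ Q x + affine (Q (⊖ y) - a) (⊖ y ⊕ ⊖ y) x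
      Q-⊖-affine x y a = begin
        Q (x ⊖ y) - a
          ≈⟨ +-congʳ (sum-cong-≋ λ k →
               solve 2 (λ x m → (x :+ m) :* (x :+ m) := x :* x :+ (m :* m :+ (m :+ m) :* x))
                 refl (x k) (- y k)) ⟩
        ∑[ k < d ] (x k * x k + (- y k * - y k + (- y k + - y k) * x k)) - a
          ≈⟨ +-congʳ (∑-distrib-+ {d} _ _) ⟩
        Q x + ∑[ k < d ] (- y k * - y k + (- y k + - y k) * x k) - a
          ≈⟨ +-congʳ (+-congˡ (∑-distrib-+ {d} _ _)) ⟩
        Q x + (Q (⊖ y) + ∑[ k < d ] ((- y k + - y k) * x k)) - a
          ≈⟨ solve 4 (λ q q′ l a → q :+ (q′ :+ l) :+ a := q :+ (q′ :+ a :+ l)) refl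
               (Q x) (Q (⊖ y)) (∑[ k < d ] ((- y k + - y k) * x k)) (- a) ⟩
        Q x + affine (Q (⊖ y) - a) (⊖ y ⊕ ⊖ y) x ∎

      null-distance-polynomial : ∀ a b y → Null (distance-polynomial a b y)
      null-distance-polynomial a b y = null-cong
        (λ x → sym (*-cong (Q-⊖-affine x y a) (Q-⊖-affine x y b)))
        (null-product _ _ _ _)

    -- Counting weights on a two-distance set.

    module _ {d n} {a b} (a≉0 : a ≉ 0#) (b≉0 : b ≉ 0#) (p : Vector (Point d) n)
      (distances : ∀ i j → i ≢ j → Q (p i ⊖ p j) ≈ a ⊎ Q (p i ⊖ p j) ≈ b) where

      distance-polynomial-root : ∀ i j → i ≢ j → distance-polynomial a b (p j) (p i) ≈ 0#
      distance-polynomial-root i j i≢j with distances i j i≢j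
      ... | inj₁ Q≈a = trans (*-congʳ (trans (+-congʳ Q≈a) (-‿inverseʳ a))) (zeroˡ _)
      ... | inj₂ Q≈b = trans (*-congˡ (trans (+-congʳ Q≈b) (-‿inverseʳ b))) (zeroʳ _)

      0-x≉0 : ∀ {x} → x ≉ 0# → 0# - x ≉ 0#
      0-x≉0 x≉0 0-x≈0 = x≉0 (sym (x∙y⁻¹≈ε⇒x≈y 0# _ 0-x≈0))

      -- The weighted sum of the distance polynomial of `p j` is zero, and all its terms except the
      -- one at `p j` vanish. The surviving term is `w j` times `(0# - a) * (0# - b)`, and both
      -- factors can be cancelled.
      monomials-separate-weights : ∀ w → (∀ μ → weigh w p (monomial μ) ≈ 0#) → ∀ j → w j ≈ 0#
      monomials-separate-weights w null-monomials j =
        *-cancelʳ-0 (0-x≉0 a≉0) (*-cancelʳ-0 (0-x≉0 b≉0) (begin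
          w j * (0# - a) * (0# - b)
            ≈⟨ *-assoc _ _ _ ⟩
          w j * ((0# - a) * (0# - b))
            ≈⟨ *-congˡ (*-cong (+-congʳ Q≈0) (+-congʳ Q≈0)) ⟨
          w j * distance-polynomial a b (p j) (p j)
            ≈⟨ sum-single (Space.ring F) _ j (λ i i≢j →
                 trans (*-congˡ (distance-polynomial-root i j i≢j)) (zeroʳ (w i))) ⟨
          weigh w p (distance-polynomial a b (p j))
            ≈⟨ Null.weigh≈0 (null-distance-polynomial a b (p j)) ⟩
          0# ∎))
        where
        open Annihilator w p null-monomials

        Q≈0 : Q (p j ⊖ p j) ≈ 0#
        Q≈0 = ≋⇒Q-⊖≈0 {d} {p j} {p j} λ _ → refl

      decodeWeights : Fin (q ^ n) → Vector Carrier n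
      decodeWeights k = decode ∘ finToFun k

      -- The linear map sending a weight to its monomial sums, with both sides coded as numbers so
      -- that injectivity yields a comparison of cardinalities.
      encodeValues : Fin (q ^ n) → Fin (q ^ bound d)
      encodeValues k = funToFin λ l →
        encode (weigh (decodeWeights k) p (monomial (Inverse.from (index↔ d) l)))

      equal-values : ∀ k k′ → encodeValues k ≡ encodeValues k′ → ∀ μ →
        weigh (decodeWeights k) p (monomial μ) ≈ weigh (decodeWeights k′) p (monomial μ)
      equal-values k k′ k∼k′ μ = ≡.subst
        (λ μ → weigh (decodeWeights k) p (monomial μ) ≈ weigh (decodeWeights k′) p (monomial μ))
        (Inverse.strictlyInverseʳ (index↔ d) μ)
        (encode-injective (≡.trans (≡.sym (finToFun-funToFin _ l))
          (≡.trans (≡.cong (λ v → finToFun v l) k∼k′) (finToFun-funToFin _ l))))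
        where
        l = Inverse.to (index↔ d) μ

      encodeValues-injective : ∀ {k k′} → encodeValues k ≡ encodeValues k′ → k ≡ k′
      encodeValues-injective {k} {k′} k∼k′ = finToFun-injective {n} λ i →
        decode-injective (x∙y⁻¹≈ε⇒x≈y _ _ (monomials-separate-weights _
          (λ μ → weigh-difference _ _ p (monomial μ) (equal-values k k′ k∼k′ μ)) i))

      -- Since `1 < q`, having `bound d < n` would make `q ^ bound d` smaller than `q ^ n`, against
      -- the injection.
      n≤bound : n ≤ bound d
      n≤bound = ℕ.≮⇒≥ λ bound<n →
        ℕ.<⇒≱ (ℕ.^-monoʳ-< q 1<q bound<n) (injective⇒≤ encodeValues-injective)

    boundValid : ∀ d → BoundValid d
    boundValid d S a b (_ , distances) a≉0 b≉0 n points =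
      n≤bound a≉0 b≉0 (proj₁ ∘ to) λ i j i≢j → Equivalence.to (distances _)
        (_ , _ , proj₂ (to i) , proj₂ (to j) , i≢j ∘ injective , refl)
      where open Injection points using (to; injective)

  -- Characteristic 3: the prime subfield and the standard bilinear form.

  module Characteristic3 (3×1≈0 : 3 ×ᴿ 1# ≈ 0#) where
    1+1≈-1 : 1# + 1# ≈ - 1#
    1+1≈-1 = begin
      1# + 1#                 ≈⟨ +-identityʳ _ ⟨
      1# + 1# + 0#            ≈⟨ +-congˡ (-‿inverseʳ 1#) ⟨
      1# + 1# + (1# - 1#)     ≈⟨ +-assoc _ _ _ ⟨
      1# + 1# + 1# - 1#       ≈⟨ +-congʳ (trans (+-assoc _ _ _) (+-congˡ (+-congˡ (sym (+-identityʳ 1#))))) ⟩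
      3 ×ᴿ 1# - 1#            ≈⟨ +-congʳ 3×1≈0 ⟩
      0# - 1#                 ≈⟨ +-identityˡ _ ⟩
      - 1#                    ∎

    ⟦_⟧₃ : 𝔽₃ → Carrier
    ⟦ 0₃ ⟧₃  = 0#
    ⟦ 1₃ ⟧₃  = 1#
    ⟦ -1₃ ⟧₃ = - 1#

    +₃-homo : ∀ a b → ⟦ a +₃ b ⟧₃ ≈ ⟦ a ⟧₃ + ⟦ b ⟧₃
    +₃-homo 0₃  b   = sym (+-identityˡ _)
    +₃-homo 1₃  0₃  = sym (+-identityʳ _)
    +₃-homo 1₃  1₃  = sym 1+1≈-1
    +₃-homo 1₃  -1₃ = sym (-‿inverseʳ 1#)
    +₃-homo -1₃ 0₃  = sym (+-identityʳ _)
    +₃-homo -1₃ 1₃  = sym (-‿inverseˡ 1#)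
    +₃-homo -1₃ -1₃ = sym (begin
      - 1# - 1#        ≈⟨ +-congʳ 1+1≈-1 ⟨
      1# + 1# - 1#     ≈⟨ +-assoc _ _ _ ⟩
      1# + (1# - 1#)   ≈⟨ +-congˡ (-‿inverseʳ 1#) ⟩
      1# + 0#          ≈⟨ +-identityʳ 1# ⟩
      1#               ∎)

    -₃-homo : ∀ a → ⟦ -₃ a ⟧₃ ≈ - ⟦ a ⟧₃
    -₃-homo 0₃  = sym -0#≈0#
    -₃-homo 1₃  = refl
    -₃-homo -1₃ = sym (-‿involutive 1#)

    *₃-homo : ∀ a b → ⟦ a *₃ b ⟧₃ ≈ ⟦ a ⟧₃ * ⟦ b ⟧₃
    *₃-homo 0₃  b = sym (zeroˡ _)
    *₃-homo 1₃  b = sym (*-identityˡ _)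
    *₃-homo -1₃ b = trans (-₃-homo b) (sym (-1*x≈-x _))

    -- Lets the ring solver normalise coefficients in `𝔽₃`, so that it proves identities special to
    -- characteristic 3.
    𝔽₃⟶F : 𝔽₃-rawRing -Raw-AlmostCommutative⟶ fromCommutativeRing (Space.ring F)
    𝔽₃⟶F = record
      { ⟦_⟧ = ⟦_⟧₃ ; +-homo = +₃-homo ; *-homo = *₃-homo ; -‿homo = -₃-homo
      ; 0-homo = refl ; 1-homo = refl }

    _coeff≟_ : ∀ a b → Maybe (⟦ a ⟧₃ ≈ ⟦ b ⟧₃)
    0₃  coeff≟ 0₃  = just refl
    1₃  coeff≟ 1₃  = just refl
    -1₃ coeff≟ -1₃ = just refl
    _   coeff≟ _   = nothing

    open RingSolver 𝔽₃-rawRing (fromCommutativeRing (Space.ring F)) 𝔽₃⟶F _coeff≟_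
      using (solve; con; _:+_; _:*_; _:-_; :-_; _:=_)

    2≉0 : 2# ≉ 0#
    2≉0 2≈0 = 1≉0 (begin
      1#        ≈⟨ -‿involutive 1# ⟨
      - - 1#    ≈⟨ -‿cong (trans (sym 1+1≈-1) 2≈0) ⟩
      - 0#      ≈⟨ -0#≈0# ⟩
      0#        ∎)

    1≉2 : 1# ≉ 2#
    1≉2 1≈2 = 1≉0 (begin
      1#             ≈⟨ solve 0 (con 1₃ := con 1₃ :+ con 1₃ :- con 1₃) refl ⟩
      1# + 1# - 1#   ≈⟨ x≈y⇒x∙y⁻¹≈ε (sym 1≈2) ⟩
      0#             ∎)

    unit⇒1⊎2 : ∀ {a} → IsUnit a → ⟦ a ⟧₃ ≈ 1# ⊎ ⟦ a ⟧₃ ≈ 2#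
    unit⇒1⊎2 {1₃}  _ = inj₁ refl
    unit⇒1⊎2 { -1₃} _ = inj₂ (sym 1+1≈-1)

    infix 7 _∙_
    _∙_ : ∀ {d} → Point d → Point d → Carrier
    x ∙ y = sum (λ k → x k * y k)

    ∙-cong : ∀ {d} {x x′ y y′ : Point d} → x ≋ x′ → y ≋ y′ → x ∙ y ≈ x′ ∙ y′
    ∙-cong {d} x≋x′ y≋y′ = sum-cong-≋ {d} λ k → *-cong (x≋x′ k) (y≋y′ k)

    ∙-comm : ∀ {d} (x y : Point d) → x ∙ y ≈ y ∙ x
    ∙-comm {d} x y = sum-cong-≋ {d} λ k → *-comm (x k) (y k)

    ∙-zeroʳ : ∀ {d} (x : Point d) → x ∙ 𝟎 ≈ 0#
    ∙-zeroʳ {d} x = trans (sum-cong-≋ {d} λ k → zeroʳ (x k)) (sum-replicate-zero d)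

    -- Shaped after one step of the recursion that interprets a `Combination`.
    ∙-linearʳ : ∀ {d} a (x y z : Point d) → x ∙ (a · y ⊕ z) ≈ a * (x ∙ y) + x ∙ z
    ∙-linearʳ {d} a x y z = begin
      x ∙ (a · y ⊕ z)
        ≈⟨ sum-cong-≋ {d} (λ k → solve 4 (λ a x y z → x :* (a :* y :+ z) := a :* (x :* y) :+ x :* z)
             refl a (x k) (y k) (z k)) ⟩
      ∑[ k < d ] (a * (x k * y k) + x k * z k)
        ≈⟨ ∑-distrib-+ {d} _ _ ⟩
      ∑[ k < d ] (a * (x k * y k)) + x ∙ z
        ≈⟨ +-congʳ (*-distribˡ-sum {d} a _) ⟨
      a * (x ∙ y) + x ∙ z ∎

    Q-⊖ : ∀ {d} (x y : Point d) → Q (x ⊖ y) ≈ x ∙ x + y ∙ y + x ∙ y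
    Q-⊖ {d} x y = begin
      Q (x ⊖ y)
        -- The coefficient -2 of the mixed term becomes 1 in `𝔽₃`.
        ≈⟨ sum-cong-≋ {d} (λ k → solve 2 (λ x y → (x :- y) :* (x :- y) := x :* x :+ y :* y :+ x :* y)
             refl (x k) (y k)) ⟩
      ∑[ k < d ] (x k * x k + y k * y k + x k * y k)
        ≈⟨ ∑-distrib-+ {d} _ _ ⟩
      ∑[ k < d ] (x k * x k + y k * y k) + x ∙ y
        ≈⟨ +-congʳ (∑-distrib-+ {d} _ _) ⟩
      x ∙ x + y ∙ y + x ∙ y ∎

    Q-cong : ∀ {d} {x y : Point d} → x ≋ y → Q x ≈ Q y
    Q-cong x≋y = ∙-cong x≋y x≋y

    e-diagonal : ∀ {d} (i : Fin d) → e i i ≈ 1#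
    e-diagonal i rewrite ≟-refl i = refl

    e-off-diagonal : ∀ {d} {i k : Fin d} → i ≢ k → e i k ≈ 0#
    e-off-diagonal {i = i} {k} i≢k rewrite dec-false (i ≟ k) i≢k = refl

    e-∙ : ∀ {d} i (x : Point d) → e i ∙ x ≈ x i
    e-∙ i x = begin
      e i ∙ x      ≈⟨ sum-single (Space.ring F) _ i (λ k k≢i →
                        trans (*-congʳ (e-off-diagonal (k≢i ∘ ≡.sym))) (zeroˡ _)) ⟩
      e i i * x i  ≈⟨ *-congʳ (e-diagonal i) ⟩
      1# * x i     ≈⟨ *-identityˡ _ ⟩
      x i          ∎

    -- The labelled points as combinations of `𝟏` and the `e i`.

    generator : ∀ {d} → Generator d → Point d
    generator nothing  = 𝟏
    generator (just i) = e i

    ⟦_⟧ : ∀ {d} → Combination d → Point d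
    ⟦ [] ⟧           = 𝟎
    ⟦ (a , g) ∷ xs ⟧ = ⟦ a ⟧₃ · generator g ⊕ ⟦ xs ⟧

    point : ∀ {d} → Index d → Point d
    point (const 0F)    = 𝟎
    point (const 1F)    = 𝟏
    point (single 0F i) = e i
    point (single 1F i) = ⊖ e i
    point (single 2F i) = v i
    point (pair i j _)  = u i j

    point≋combination : ∀ {d} (l : Index d) → point l ≋ ⟦ combination l ⟧
    point≋combination (const 0F)    k = refl
    point≋combination (const 1F)    k = solve 0 (con 1₃ := con 1₃ :* con 1₃ :+ con 0₃) refl
    point≋combination (single 0F i) k =
      solve 1 (λ e → e := con 0₃ :* con 1₃ :+ (con 1₃ :* e :+ con 0₃)) refl (e i k)
    point≋combination (single 1F i) k =
      solve 1 (λ e → :- e := con 0₃ :* con 1₃ :+ (con -1₃ :* e :+ con 0₃)) refl (e i k)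
    point≋combination (single 2F i) k =
      solve 1 (λ e → :- con 1₃ :+ (con 1₃ :+ con 1₃) :* e
                  := con -1₃ :* con 1₃ :+ (con -1₃ :* e :+ con 0₃)) refl (e i k)
    point≋combination (pair i j _)  k =
      solve 2 (λ e f → con 1₃ :- (con 1₃ :+ con 1₃) :* e :- (con 1₃ :+ con 1₃) :* f
                    := con 1₃ :* con 1₃ :+ (con 1₃ :* e :+ (con 1₃ :* f :+ con 0₃)))
        refl (e i k) (e j k)

    -- Distances and size of `𝒮 d` for `d` congruent to 2 modulo 3.

    module _ {d} (d%3≡2 : d % 3 ≡ 2) where

      -- The multiple of 3 vanishes and the remainder 2 equals -1. This gives the entry `-1₃` of
      -- `gram`.
      d×1≈-1 : d ×ᴿ 1# ≈ - 1#
      d×1≈-1 = begin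
        d ×ᴿ 1#                              ≈⟨ ×-congˡ (m≡m%n+[m/n]*n d 3) ⟩
        (d % 3 ℕ.+ d ℕ./ 3 ℕ.* 3) ×ᴿ 1#      ≈⟨ ×-congˡ (≡.cong (ℕ._+ d ℕ./ 3 ℕ.* 3) d%3≡2) ⟩
        (2 ℕ.+ d ℕ./ 3 ℕ.* 3) ×ᴿ 1#          ≈⟨ ×-homo-+ 1# 2 (d ℕ./ 3 ℕ.* 3) ⟩
        2 ×ᴿ 1# + (d ℕ./ 3 ℕ.* 3) ×ᴿ 1#      ≈⟨ +-congˡ (×1-homo-* (d ℕ./ 3) 3) ⟩
        2 ×ᴿ 1# + (d ℕ./ 3) ×ᴿ 1# * 3 ×ᴿ 1#  ≈⟨ +-cong (+-congˡ (+-identityʳ 1#)) (*-congˡ 3×1≈0) ⟩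
        1# + 1# + (d ℕ./ 3) ×ᴿ 1# * 0#       ≈⟨ +-cong 1+1≈-1 (zeroʳ _) ⟩
        - 1# + 0#                            ≈⟨ +-identityʳ _ ⟩
        - 1#                                 ∎

      generator-∙ : ∀ (g h : Generator d) → generator g ∙ generator h ≈ ⟦ gram g h ⟧₃
      generator-∙ nothing  nothing  =
        trans (sum-cong-≋ {d} λ _ → *-identityˡ 1#) (trans (sum-replicate d) d×1≈-1)
      generator-∙ nothing  (just i) = trans (∙-comm 𝟏 (e i)) (e-∙ i 𝟏)
      generator-∙ (just i) nothing  = e-∙ i 𝟏
      generator-∙ (just i) (just j) = trans (e-∙ i (e j)) e≈gram
        where
        e≈gram : e j i ≈ ⟦ gram (just i) (just j) ⟧₃
        e≈gram with does (j ≟ i)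
        ... | true  = refl
        ... | false = refl

      generator-∙-⟦⟧ : ∀ g (ys : Combination d) → generator g ∙ ⟦ ys ⟧ ≈ ⟦ dot-generator g ys ⟧₃
      generator-∙-⟦⟧ g []             = ∙-zeroʳ (generator g)
      generator-∙-⟦⟧ g ((b , h) ∷ ys) = begin
        generator g ∙ (⟦ b ⟧₃ · generator h ⊕ ⟦ ys ⟧)
          ≈⟨ ∙-linearʳ ⟦ b ⟧₃ (generator g) (generator h) ⟦ ys ⟧ ⟩
        ⟦ b ⟧₃ * (generator g ∙ generator h) + generator g ∙ ⟦ ys ⟧
          ≈⟨ +-cong (*-congˡ (generator-∙ g h)) (generator-∙-⟦⟧ g ys) ⟩
        ⟦ b ⟧₃ * ⟦ gram g h ⟧₃ + ⟦ dot-generator g ys ⟧₃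
          ≈⟨ +-congʳ (*₃-homo b (gram g h)) ⟨
        ⟦ b *₃ gram g h ⟧₃ + ⟦ dot-generator g ys ⟧₃
          ≈⟨ +₃-homo (b *₃ gram g h) _ ⟨
        ⟦ b *₃ gram g h +₃ dot-generator g ys ⟧₃ ∎

      ⟦⟧-∙ : ∀ (xs ys : Combination d) → ⟦ xs ⟧ ∙ ⟦ ys ⟧ ≈ ⟦ dot xs ys ⟧₃
      ⟦⟧-∙ []             ys = trans (∙-comm 𝟎 ⟦ ys ⟧) (∙-zeroʳ ⟦ ys ⟧)
      ⟦⟧-∙ ((a , g) ∷ xs) ys = begin
        (⟦ a ⟧₃ · generator g ⊕ ⟦ xs ⟧) ∙ ⟦ ys ⟧
          ≈⟨ ∙-comm _ ⟦ ys ⟧ ⟩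
        ⟦ ys ⟧ ∙ (⟦ a ⟧₃ · generator g ⊕ ⟦ xs ⟧)
          ≈⟨ ∙-linearʳ ⟦ a ⟧₃ ⟦ ys ⟧ (generator g) ⟦ xs ⟧ ⟩
        ⟦ a ⟧₃ * (⟦ ys ⟧ ∙ generator g) + ⟦ ys ⟧ ∙ ⟦ xs ⟧
          ≈⟨ +-cong (*-congˡ (trans (∙-comm ⟦ ys ⟧ (generator g)) (generator-∙-⟦⟧ g ys)))
                    (trans (∙-comm ⟦ ys ⟧ ⟦ xs ⟧) (⟦⟧-∙ xs ys)) ⟩
        ⟦ a ⟧₃ * ⟦ dot-generator g ys ⟧₃ + ⟦ dot xs ys ⟧₃
          ≈⟨ +-congʳ (*₃-homo a (dot-generator g ys)) ⟨
        ⟦ a *₃ dot-generator g ys ⟧₃ + ⟦ dot xs ys ⟧₃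
          ≈⟨ +₃-homo (a *₃ dot-generator g ys) _ ⟨
        ⟦ a *₃ dot-generator g ys +₃ dot xs ys ⟧₃ ∎

      point-∙ : ∀ (l m : Index d) → point l ∙ point m ≈ ⟦ dot (combination l) (combination m) ⟧₃
      point-∙ l m = trans (∙-cong (point≋combination l) (point≋combination m))
        (⟦⟧-∙ (combination l) (combination m))

      point-norm : ∀ (l : Index d) → point l ∙ point l ≈ ⟦ norm l ⟧₃
      point-norm l = trans (point-∙ l l) (reflexive (≡.cong ⟦_⟧₃ (dot-combination l)))

      point-distance : ∀ (l m : Index d) → Q (point l ⊖ point m) ≈ ⟦ distance l m ⟧₃
      point-distance l m = begin
        Q (point l ⊖ point m)
          ≈⟨ Q-⊖ (point l) (point m) ⟩
        point l ∙ point l + point m ∙ point m + point l ∙ point m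
          ≈⟨ +-cong (+-cong (point-norm l) (point-norm m)) (point-∙ l m) ⟩
        ⟦ norm l ⟧₃ + ⟦ norm m ⟧₃ + ⟦ dot (combination l) (combination m) ⟧₃
          ≈⟨ +-congʳ (+₃-homo (norm l) (norm m)) ⟨
        ⟦ norm l +₃ norm m ⟧₃ + ⟦ dot (combination l) (combination m) ⟧₃
          ≈⟨ +₃-homo (norm l +₃ norm m) _ ⟨
        ⟦ distance l m ⟧₃ ∎

      point-separated : ∀ (l m : Index d) →
        l ≡ m ⊎ (Q (point l ⊖ point m) ≈ 1# ⊎ Q (point l ⊖ point m) ≈ 2#)
      point-separated l m = Sum⊎.map₂
        (λ unit → Sum⊎.map (trans (point-distance l m)) (trans (point-distance l m)) (unit⇒1⊎2 unit))
        (separated l m)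

      point-injective : ∀ (l m : Index d) → point l ≋ point m → l ≡ m
      point-injective l m l≋m with point-separated l m
      ... | inj₁ l≡m        = l≡m
      ... | inj₂ (inj₁ Q≈1) = contradiction (trans (sym Q≈1) (≋⇒Q-⊖≈0 l≋m)) 1≉0
      ... | inj₂ (inj₂ Q≈2) = contradiction (trans (sym Q≈2) (≋⇒Q-⊖≈0 l≋m)) 2≉0

      point∈𝒮 : ∀ (l : Index d) → 𝒮 d (point l)
      point∈𝒮 (const 0F)      = is-𝟎 λ _ → refl
      point∈𝒮 (const 1F)      = is-𝟏 λ _ → refl
      point∈𝒮 (single 0F i)   = is-e i λ _ → refl
      point∈𝒮 (single 1F i)   = is-⊖e i λ _ → refl
      point∈𝒮 (single 2F i)   = is-v i λ _ → refl
      point∈𝒮 (pair i j i<j)  = is-u i j i<j λ _ → refl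

      index : ∀ {x : Point d} → 𝒮 d x → ∃[ l ] x ≋ point l
      index (is-𝟎 x≋)         = const 0F , x≋
      index (is-𝟏 x≋)         = const 1F , x≋
      index (is-e i x≋)       = single 0F i , x≋
      index (is-⊖e i x≋)      = single 1F i , x≋
      index (is-u i j i<j x≋) = pair i j i<j , x≋
      index (is-v i x≋)       = single 2F i , x≋

      twoDistance : 1 ≤ d → IsTwoDistanceSet (𝒮 d) 1# 2#
      twoDistance 1≤d = 1≉2 , λ t → mk⇔ to from
        where
        to : ∀ {t} → IsSquaredDistance (𝒮 d) t → t ≈ 1# ⊎ t ≈ 2#
        to (x , y , x∈𝒮 , y∈𝒮 , x≉y , Q≈t) with index x∈𝒮 | index y∈𝒮
        ... | l , x≋l | m , y≋m with point-separated l m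
        ... | inj₁ ≡.refl = contradiction (λ k → trans (x≋l k) (sym (y≋m k))) x≉y
        ... | inj₂ Q≈1⊎2  = Sum⊎.map (trans t≈Q) (trans t≈Q) Q≈1⊎2
          where t≈Q = trans (sym Q≈t) (Q-cong λ k → +-cong (x≋l k) (-‿cong (y≋m k)))

        attained : ∀ (l m : Index d) {t a} → ⟦ distance l m ⟧₃ ≈ a → l ≢ m → t ≈ a →
          IsSquaredDistance (𝒮 d) t
        attained l m ≈a l≢m t≈a = point l , point m , point∈𝒮 l , point∈𝒮 m , l≢m ∘ point-injective l m ,
          trans (point-distance l m) (trans ≈a (sym t≈a))

        from : ∀ {t} → t ≈ 1# ⊎ t ≈ 2# → IsSquaredDistance (𝒮 d) t
        -- The origin and the first basis vector, which exists because `1 ≤ d`, are at distance 1.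
        from (inj₁ t≈1) = attained (const 0F) (single 0F (Fin.fromℕ< 1≤d)) refl (λ ()) t≈1
        -- The origin and `𝟏` are at distance `d`, which is -1 and hence 2 in `F`.
        from (inj₂ t≈2) = attained (const 0F) (const 1F) (sym 1+1≈-1) (λ ()) t≈2

      -- Membership proofs are ignored by `subsetSetoid`, so the label read off such a proof must
      -- depend on the point alone; injectivity of `point` ensures this.
      index-unique : ∀ {x} (x∈𝒮 : 𝒮 d x) l → x ≋ point l → proj₁ (index x∈𝒮) ≡ l
      index-unique x∈𝒮 l x≋l = point-injective _ l λ k → trans (sym (proj₂ (index x∈𝒮) k)) (x≋l k)

      size-𝒮 : HasSize (subsetSetoid (𝒮 d)) (bound d)
      size-𝒮 = record
        { to        = λ (_ , x∈𝒮) → to (proj₁ (index x∈𝒮))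
        ; from      = λ k → point (from k) , point∈𝒮 (from k)
        ; to-cong   = λ { {_ , x∈𝒮} {_ , y∈𝒮} x≋y → ≡.cong to
            (index-unique x∈𝒮 _ λ k → trans (x≋y k) (proj₂ (index y∈𝒮) k)) }
        ; from-cong = λ { ≡.refl k → refl }
        ; inverse   =
            (λ { {k} {_ , x∈𝒮} x≋k →
              ≡.trans (≡.cong to (index-unique x∈𝒮 (from k) x≋k)) (strictlyInverseˡ k) })
          , (λ { {_ , x∈𝒮} ≡.refl i → trans
              (reflexive (≡.cong (λ l → point l i) (strictlyInverseʳ (proj₁ (index x∈𝒮)))))
              (sym (proj₂ (index x∈𝒮) i)) })
        }
        where open Inverse (index↔ d) using (to; from; strictlyInverseˡ; strictlyInverseʳ)

theorem3p1 : ∀ {c ℓ₁ ℓ₂} (r : ℕ) → 1 ≤ r →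
    (F : HeytingField c ℓ₁ ℓ₂) → HasSize (HeytingField.setoid F) (3 ^ r) →
    let open Space F in
    (∀ d → 2 ≤ d → d % 3 ≡ 2 →
    IsTwoDistanceSet (𝒮 d) 1# 2# × 1# ≉ 0# × 2# ≉ 0# ×
    HasSize (subsetSetoid (𝒮 d)) (bound d))
    × (∀ d → BoundValid d)
    × (∀ N → ∃[ d ] N < d × BoundAttained d)
theorem3p1 r 1≤r F size =
  -- Strict monotonicity gives `3 ^ 0 < 3 ^ r`, that is, `1 < q`.
  attains , Bound.boundValid (ℕ.^-monoʳ-< 3 (s≤s (s≤s z≤n)) 1≤r) size , unbounded
  where
  open Space F
  open Field F
  -- The additive group has order `3 ^ r`, so `3 ^ r` annihilates 1, and therefore so does 3.
  open Characteristic3 (^×1≈0⇒×1≈0 3 r (size×≈0 ring size 1#))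

  attains : ∀ d → 2 ≤ d → d % 3 ≡ 2 →
    IsTwoDistanceSet (𝒮 d) 1# 2# × 1# ≉ 0# × 2# ≉ 0# × HasSize (subsetSetoid (𝒮 d)) (bound d)
  attains d 2≤d d%3≡2 = twoDistance d%3≡2 (ℕ.<⇒≤ 2≤d) , 1≉0 , 2≉0 , size-𝒮 d%3≡2

  unbounded : ∀ N → ∃[ d ] N < d × BoundAttained d
  -- The dimension `2 + 3N` lies in the right residue class and exceeds `N`, also for `N = 0`.
  unbounded N = d , ℕ.m≤n⇒m≤o+n 1 (s≤s (ℕ.m≤m*n N 3)) , 𝒮 d , 1# , 2# ,
    attains d (s≤s (s≤s z≤n)) ([m+kn]%n≡m%n 2 N 3)
    where d = 2 ℕ.+ N ℕ.* 3
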